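{- Let $A\subseteq\omega$ be an infinite c.e. set, $n\ge1$, and let $\theta^{(n)}$ be a numbering of $\mathcal S^{(n)}_A$ satisfying condition (QGN I), i.e. the extended graph of the $(n+1)$-ary function $(i,\vec x)\mapsto\theta^{(n)}_i(\vec x)$ is the range of a total computable function $\omega\to\omega$. Then there are a primitive recursive function $q:\omega\to\omega$ and an $(n+2)$-ary computable predicate $T$ such that for all $i\in\omega$ and $\vec x\in\omega^n$, $$\theta^{(n)}_i(\vec x)=q\big(\mu y.\,T(i,\vec x,y)\big)$$ (both sides being undefined or both being defined and equal).
   Context: $\omega$ is the set of natural numbers; $\mathcal R^{(n)}$ is the set of total computable functions $\omega^n\to\omega$. $\langle\cdot,\cdot\rangle:\omega^2\to\omega$ is a computable bijection with $\langle x,y\rangle\ge x,y$ (it may be chosen primitive recursive with primitive recursive inverses), extended by $\langle x\rangle=x$, $\langle x_1,\dots,x_{n+1}\rangle=\langle x_1,\langle x_2,\dots,x_{n+1}\rangle\rangle$. $\mathrm{Anf}^{(n)}_A$ is the set of partial functions from $\omega^n$ to $\omega$ whose domain is either empty or equal to $\{0,\dots,a-1\}^n$ for some $a\in A$, and $\mathcal S^{(n)}_A=\mathcal R^{(n)}\cup\mathrm{Anf}^{(n)}_A$. A numbering of a set $X$ is a surjection $\omega\to X$. The extended graph of an $m$-ary partial function $q$ is $\{\langle\langle\vec y\rangle,0\rangle:\vec y\in\omega^m\}\cup\{\langle\langle\vec x\rangle,q(\vec x)+1\rangle:\vec x\in\mathrm{dom}(q)\}$. $\mu y.\,T(i,\vec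 x,y)$ is the least $y$ with $T(i,\vec x,y)$, undefined if there is none. -}

module Defs where

open import Data.Fin using (Fin)
open import Data.List using (List)
open import Data.List.Membership.Propositional using () renaming (_∈_ to _∈ᴸ_)
open import Data.Nat using (ℕ; zero; suc; _≤_; _<_)
open import Data.Nat.Properties using (<-cmp)
open import Data.Product using (Σ; ∃; ∃-syntax; _×_; _,_; uncurry)
open import Data.Sum using (_⊎_)
open import Data.Vec using (Vec; []; _∷_; _∷ʳ_; head; lookup)
open import Data.Vec.Relation.Unary.All using (All)
open import Function.Bundles using (_⇔_)
open import Function.Definitions using (Bijective)
open import Level using (0ℓ)
open import Relation.Binary.Definitions using (tri<; tri≈; tri>)
open import Relation.Binary.PropositionalEquality using (_≡_; cong; trans; sym)
open import Relation.Nullary using (¬_; contradiction)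
open import Relation.Unary using (Pred; _∈_; _⊆_; _∪_; _≐_)

data Kind : Set where
  primrec general : Kind

-- Minimisation is available only for general codes, so the codes of
-- kind primrec are exactly those of primitive recursive functions.
data Code : Kind → ℕ → Set where
  zeroᶜ : ∀ {k n} → Code k n
  succᶜ : ∀ {k} → Code k 1
  projᶜ : ∀ {k n} → Fin n → Code k n
  compᶜ : ∀ {k m n} → Code k m → Vec (Code k n) m → Code k n
  precᶜ : ∀ {k n} → Code k n → Code k (suc (suc n)) → Code k (suc n)
  minᶜ  : ∀ {n} → Code general (suc n) → Code general n

infix 4 _[_]↦_

-- Composition is strict, and minimisation requires the values below the least
-- zero to be defined.
data _[_]↦_ : ∀ {k n} → Code k n → Vec ℕ n → ℕ → Set where
  ↦zero : ∀ {k n} {xs : Vec ℕ n} → zeroᶜ {k} [ xs ]↦ 0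
  ↦succ : ∀ {k x} → succᶜ {k} [ x ∷ [] ]↦ suc x
  ↦proj : ∀ {k n} {xs : Vec ℕ n} (j : Fin n) → projᶜ {k} j [ xs ]↦ lookup xs j
  ↦comp : ∀ {k m n} {f : Code k m} {gs : Vec (Code k n) m} {xs ys z} →
          (∀ j → lookup gs j [ xs ]↦ lookup ys j) →
          f [ ys ]↦ z →
          compᶜ f gs [ xs ]↦ z
  ↦prec-zero : ∀ {k n} {f : Code k n} {g xs y} →
          f [ xs ]↦ y →
          precᶜ f g [ zero ∷ xs ]↦ y
  ↦prec-suc : ∀ {k n} {f : Code k n} {g xs m r y} →
          precᶜ f g [ m ∷ xs ]↦ r →
          g [ m ∷ r ∷ xs ]↦ y →
          precᶜ f g [ suc m ∷ xs ]↦ y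
  ↦min : ∀ {n} {f : Code general (suc n)} {xs y} →
          f [ y ∷ xs ]↦ 0 →
          (∀ z → z < y → ∃[ r ] f [ z ∷ xs ]↦ suc r) →
          minᶜ f [ xs ]↦ y

Computes : ∀ {k n} → Code k n → (Vec ℕ n → ℕ) → Set
Computes c f = ∀ xs → c [ xs ]↦ f xs

Computable : ∀ {n} → (Vec ℕ n → ℕ) → Set
Computable f = ∃[ c ] Computes {general} c f

PrimitiveRecursive : ∀ {n} → (Vec ℕ n → ℕ) → Set
PrimitiveRecursive f = ∃[ c ] Computes {primrec} c f

unary : (ℕ → ℕ) → Vec ℕ 1 → ℕ
unary f xs = f (head xs)

binary : (ℕ → ℕ → ℕ) → Vec ℕ 2 → ℕ
binary f (x ∷ y ∷ []) = f x y

ComputablePredicate : ∀ {n} → Pred (Vec ℕ n) 0ℓ → Set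
ComputablePredicate {n} T =
  Σ (Vec ℕ n → ℕ) λ χ → Computable χ ×
    (∀ xs → (xs ∈ T × χ xs ≡ 1) ⊎ (¬ (xs ∈ T) × χ xs ≡ 0))

CE : Pred ℕ 0ℓ → Set
CE A = Σ (Code general 1) λ c → ∀ a → (a ∈ A) ⇔ (∃[ y ] c [ a ∷ [] ]↦ y)

Infinite : Pred ℕ 0ℓ → Set
Infinite A = ¬ (Σ (List ℕ) λ as → A ⊆ (_∈ᴸ as))

Range : (ℕ → ℕ) → Pred ℕ 0ℓ
Range g z = ∃[ s ] g s ≡ z

record PartialFun (n : ℕ) : Set₁ where
  field
    graph      : Vec ℕ n → ℕ → Set
    functional : ∀ {xs y z} → graph xs y → graph xs z → y ≡ z

open PartialFun public

dom : ∀ {n} → PartialFun n → Pred (Vec ℕ n) 0ℓ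
dom f xs = ∃[ y ] graph f xs y

infix 4 _≃_
_≃_ : ∀ {n} → PartialFun n → PartialFun n → Set
f ≃ g = ∀ xs y → graph f xs y ⇔ graph g xs y

joint : ∀ {n} → (ℕ → PartialFun n) → PartialFun (suc n)
graph      (joint θ) (i ∷ xs) y = graph (θ i) xs y
functional (joint θ) {i ∷ xs}   = functional (θ i)

-- The argument minimised over is the last one.
μ : ∀ {n} → Pred (Vec ℕ (suc n)) 0ℓ → PartialFun n
graph (μ T) xs y = (xs ∷ʳ y) ∈ T × (∀ z → z < y → ¬ ((xs ∷ʳ z) ∈ T))
functional (μ T) {xs} {y} {z} (Ty , y-least) (Tz , z-least) with <-cmp y z
... | tri< y<z _ _ = contradiction Ty (z-least y y<z)
... | tri≈ _ y≡z _ = y≡z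
... | tri> _ _ z<y = contradiction Tz (y-least z z<y)

infixr 9 _∘ₚ_
_∘ₚ_ : ∀ {n} → (ℕ → ℕ) → PartialFun n → PartialFun n
graph      (q ∘ₚ f) xs v = ∃[ y ] graph f xs y × v ≡ q y
functional (q ∘ₚ f) (y , fy , v≡) (z , fz , w≡) =
  trans v≡ (trans (cong q (functional f fy fz)) (sym w≡))

𝓡 : ∀ n → Pred (PartialFun n) 0ℓ
𝓡 n f = Σ (Vec ℕ n → ℕ) λ g → Computable g × (∀ xs → graph f xs (g xs))

Anf : Pred ℕ 0ℓ → ∀ n → Pred (PartialFun n) 0ℓ
Anf A n f = (∀ xs → ¬ (xs ∈ dom f))
          ⊎ (∃[ a ] a ∈ A × (∀ xs → (xs ∈ dom f) ⇔ All (_< a) xs))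

𝓢 : Pred ℕ 0ℓ → ∀ n → Pred (PartialFun n) 0ℓ
𝓢 A n = 𝓡 n ∪ Anf A n

-- The double negations give the classical reading of
-- membership and surjectivity: without them, a numbering of 𝓢 A n would have to
-- come with a procedure deciding whether θ i is total.
record IsNumbering {n} (θ : ℕ → PartialFun n) (X : Pred (PartialFun n) 0ℓ) : Set₁ where
  field
    member     : ∀ i → ¬ ¬ (θ i ∈ X)
    surjective : ∀ f → f ∈ X → ¬ ¬ (∃[ i ] θ i ≃ f)

record Pairing : Set where
  field
    pair       : ℕ → ℕ → ℕ
    computable : Computable (binary pair)
    bijective  : Bijective _≡_ _≡_ (uncurry pair)
    fst≤pair   : ∀ x y → x ≤ pair x y
    snd≤pair   : ∀ x y → y ≤ pair x y

  tuple : ∀ {n} → Vec ℕ (suc n) → ℕ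
  tuple (x ∷ [])         = x
  tuple (x ∷ xs@(_ ∷ _)) = pair x (tuple xs)

  ExtendedGraph : ∀ {n} → PartialFun (suc n) → Pred ℕ 0ℓ
  ExtendedGraph {n} q z =
      (Σ (Vec ℕ (suc n)) λ ys → z ≡ pair (tuple ys) 0)
    ⊎ (∃[ xs ] ∃[ v ] graph q xs v × z ≡ pair (tuple xs) (suc v))

  QGN-I : ∀ {n} → (ℕ → PartialFun n) → Set
  QGN-I θ = Σ (ℕ → ℕ) λ g → Computable (unary g) × (ExtendedGraph (joint θ) ≐ Range g)

{-# OPTIONS --safe #-}
module Submission where

open import Data.Fin using (Fin; zero; suc; inject₁; fromℕ)
open import Data.Nat using (ℕ; zero; suc; pred; _+_; _∸_; _≤_; _<_)
open import Data.Nat.Induction using (<-rec)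
open import Data.Nat.Properties
open import Data.Product using (Σ; ∃-syntax; _×_; _,_; proj₁; proj₂)
open import Data.Sum using (_⊎_; inj₁; inj₂)
open import Data.Vec using (Vec; []; _∷_; _∷ʳ_; lookup; tabulate)
open import Data.Vec.Properties using (lookup∘tabulate; tabulate∘lookup)
open import Function using (_∘_; id; mk⇔)
open import Function.Bundles using (_⇔_)
open import Level using (0ℓ)
open import Relation.Binary.Definitions using (tri<; tri≈; tri>)
open import Relation.Binary.PropositionalEquality
open import Relation.Nullary using (¬_; yes; no; contradiction)
open import Relation.Unary using (Pred; Decidable)
open import Defs

-- Let g enumerate the extended graph.  The minimisation searches for a Cantor
-- code of a pair (s , v) such that g s codes ((i , xs) , v + 1), and q is the
-- second projection.  Cantor's pairing replaces the given one here because the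
-- latter need not have primitive recursive inverses; storing v next to s makes
-- T decidable by a single evaluation of g.

-- The kind is a parameter so that one construction serves both the primitive recursiveness of `q`
-- and the computability of `T`.
Represented : ∀ {n} → Kind → (Vec ℕ n → ℕ) → Set
Represented {n} k f = ∃[ c ] Computes {k} {n} c f

private
  variable
    k : Kind
    m n : ℕ

-- Closure properties of represented functions.

represented-cong : {f g : Vec ℕ n → ℕ} → (∀ xs → f xs ≡ g xs) →
  Represented k f → Represented k g
represented-cong f≗g (c , c↦) = c , λ xs → subst (c [ xs ]↦_) (f≗g xs) (c↦ xs)

represented-lookup : (j : Fin n) → Represented k (λ xs → lookup xs j)
represented-lookup j = projᶜ j , λ _ → ↦proj j

represented-suc : Represented k (unary suc)
represented-suc = succᶜ , λ { (x ∷ []) → ↦succ }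

-- For a concrete `m` the `tabulate` reduces to a literal vector, so the unary and binary versions
-- below are direct instances.
represented-∘ : {f : Vec ℕ m → ℕ} {h : Fin m → Vec ℕ n → ℕ} →
  Represented k f → (∀ j → Represented k (h j)) →
  Represented k (λ xs → f (tabulate λ j → h j xs))
represented-∘ {h = h} (c , c↦) r =
  compᶜ c (tabulate (proj₁ ∘ r)) , λ xs → ↦comp (args xs) (c↦ _)
  where
  args : ∀ xs j → lookup (tabulate (proj₁ ∘ r)) j [ xs ]↦ lookup (tabulate λ j → h j xs) j
  args xs j
    rewrite lookup∘tabulate (proj₁ ∘ r) j | lookup∘tabulate (λ j → h j xs) j
    = proj₂ (r j) xs

represented-∘₁ : ∀ f {h : Vec ℕ n → ℕ} →
  Represented k (unary f) → Represented k h → Represented k (λ xs → f (h xs))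
represented-∘₁ _ {h} rf rh = represented-∘ {h = λ _ → h} rf λ _ → rh

represented-∘₂ : ∀ {f} {h₁ h₂ : Vec ℕ n → ℕ} →
  Represented k (binary f) → Represented k h₁ → Represented k h₂ →
  Represented k (λ xs → f (h₁ xs) (h₂ xs))
represented-∘₂ {h₁ = h₁} {h₂} rf rh₁ rh₂ =
  represented-∘ {h = λ { zero → h₁ ; (suc _) → h₂ }} rf λ { zero → rh₁ ; (suc _) → rh₂ }

represented-reindex : {f : Vec ℕ m → ℕ} → Represented k f → (ρ : Fin m → Fin n) →
  Represented k (λ xs → f (tabulate (lookup xs ∘ ρ)))
represented-reindex rf ρ = represented-∘ rf (represented-lookup ∘ ρ)

-- Here `f` is given beforehand and is only required to satisfy the recursion equations. Induction
-- on the first argument carries each derivation for `precᶜ` along them.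
represented-rec : {f : Vec ℕ (suc n) → ℕ} {z : Vec ℕ n → ℕ} {s : Vec ℕ (suc (suc n)) → ℕ} →
  Represented k z → Represented k s →
  (∀ xs → z xs ≡ f (0 ∷ xs)) →
  (∀ m xs → s (m ∷ f (m ∷ xs) ∷ xs) ≡ f (suc m ∷ xs)) →
  Represented k f
represented-rec {f = f} (cz , cz↦) (cs , cs↦) z≡ s≡ =
  precᶜ cz cs , λ { (m ∷ xs) → go m xs }
  where
  go : ∀ m xs → precᶜ cz cs [ m ∷ xs ]↦ f (m ∷ xs)
  go 0       xs = ↦prec-zero (subst (cz [ xs ]↦_) (z≡ xs) (cz↦ xs))
  go (suc m) xs = ↦prec-suc (go m xs) (subst (cs [ _ ]↦_) (s≡ m xs) (cs↦ _))

-- Arithmetic and the equality test.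

represented-zero : Represented {n} k (λ _ → 0)
represented-zero = zeroᶜ , λ _ → ↦zero

represented-one : Represented {n} k (λ _ → 1)
represented-one = represented-∘₁ suc represented-suc represented-zero

represented-+ : Represented k (binary _+_)
represented-+ = represented-rec
  (represented-lookup zero)
  (represented-∘₁ suc represented-suc (represented-lookup (suc zero)))
  (λ { (y ∷ []) → refl })
  (λ { m (y ∷ []) → refl })

represented-pred : Represented k (unary pred)
represented-pred = represented-rec represented-zero (represented-lookup zero)
  (λ { [] → refl })
  (λ { m [] → refl })

represented-∸ : Represented k (binary _∸_)
represented-∸ = represented-cong (λ { (x ∷ y ∷ []) → refl })
  (represented-∘₂ {f = λ y x → x ∸ y} flipped
    (represented-lookup (suc zero)) (represented-lookup zero))
  where
  -- Primitive recursion runs on the first argument, whereas iterating `pred` counts the subtrahend,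
  -- so the subtrahend is put first.
  flipped : Represented k (binary λ y x → x ∸ y)
  flipped = represented-rec
    (represented-lookup zero)
    (represented-∘₁ pred represented-pred (represented-lookup (suc zero)))
    (λ { (x ∷ []) → refl })
    (λ { m (x ∷ []) → pred[m∸n]≡m∸[1+n] x m })

-- One of the two truncated differences is always 0, so their sum is the distance between `x` and
-- `y`.
isEqual : ℕ → ℕ → ℕ
isEqual x y = 1 ∸ ((x ∸ y) + (y ∸ x))

isEqual-≡ : ∀ {x y} → x ≡ y → isEqual x y ≡ 1
isEqual-≡ {x} refl rewrite n∸n≡0 x = refl

isEqual-≢ : ∀ {x y} → x ≢ y → isEqual x y ≡ 0
isEqual-≢ {x} {y} x≢y with <-cmp x y
... | tri< x<y _ _ = m≤n⇒m∸n≡0 (≤-trans (m<n⇒0<n∸m x<y) (m≤n+m _ (x ∸ y)))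
... | tri≈ _ x≡y _ = contradiction x≡y x≢y
... | tri> _ _ y<x = m≤n⇒m∸n≡0 (≤-trans (m<n⇒0<n∸m y<x) (m≤m+n _ (y ∸ x)))

represented-isEqual : {f g : Vec ℕ n → ℕ} → Represented k f → Represented k g →
  Represented k (λ xs → isEqual (f xs) (g xs))
represented-isEqual rf rg =
  represented-∘₂ represented-∸ represented-one
    (represented-∘₂ represented-+
      (represented-∘₂ represented-∸ rf rg)
      (represented-∘₂ represented-∸ rg rf))

≡-computablePredicate : {f g : Vec ℕ n → ℕ} → Computable f → Computable g →
  ComputablePredicate (λ xs → f xs ≡ g xs)
≡-computablePredicate {f = f} {g} cf cg = _ , represented-isEqual cf cg , decide
  where
  decide : ∀ xs → (f xs ≡ g xs × isEqual (f xs) (g xs) ≡ 1)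
                ⊎ (¬ (f xs ≡ g xs) × isEqual (f xs) (g xs) ≡ 0)
  decide xs with f xs ≟ g xs
  ... | yes f≡g = inj₁ (f≡g , isEqual-≡ f≡g)
  ... | no  f≢g = inj₂ (f≢g , isEqual-≢ f≢g)

tabulate-inject₁-∷ʳ : (xs : Vec ℕ n) (y : ℕ) → tabulate (lookup (xs ∷ʳ y) ∘ inject₁) ≡ xs
tabulate-inject₁-∷ʳ []       y = refl
tabulate-inject₁-∷ʳ (x ∷ xs) y = cong (x ∷_) (tabulate-inject₁-∷ʳ xs y)

lookup-fromℕ-∷ʳ : (xs : Vec ℕ n) (y : ℕ) → lookup (xs ∷ʳ y) (fromℕ n) ≡ y
lookup-fromℕ-∷ʳ []       y = refl
lookup-fromℕ-∷ʳ (x ∷ xs) y = lookup-fromℕ-∷ʳ xs y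

-- Cantor pairing along diagonals.

triangle : ℕ → ℕ
triangle 0       = 0
triangle (suc m) = suc m + triangle m

-- The increment is 1 exactly when suc y reaches the next triangular number.
triangleRoot : ℕ → ℕ
triangleRoot 0       = 0
triangleRoot (suc y) =
  triangleRoot y + (1 ∸ (triangle (suc (triangleRoot y)) ∸ suc y))

-- Diagonal `r` starts at `triangle r` and has offsets 0 to `r`. The induction steps back one point
-- at a time, and inside a diagonal the increment is 0 because `triangle (suc r)` is not yet
-- reached.
triangleRoot-correct : ∀ d r → d ≤ r → triangleRoot (d + triangle r) ≡ r
triangleRoot-correct 0 0 _ = refl
-- The start of diagonal `suc r` is the successor of the last point of diagonal `r`, the one at
-- offset `r`; there the increment is 1.
triangleRoot-correct 0 (suc r) _
  rewrite triangleRoot-correct r r ≤-refl | n∸n≡0 (r + triangle r) = +-comm r 1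
triangleRoot-correct (suc d) r d<r
  rewrite triangleRoot-correct d r (<⇒≤ d<r)
        | m≤n⇒m∸n≡0 (m<n⇒0<n∸m (+-monoˡ-< (triangle r) d<r)) = +-identityʳ r

-- The point at offset `v` on diagonal `s + v`. As `v ≤ s + v`, `triangleRoot` recovers the
-- diagonal.
cantor : ℕ → ℕ → ℕ
cantor s v = v + triangle (s + v)

cantor₂ : ℕ → ℕ
cantor₂ y = y ∸ triangle (triangleRoot y)

cantor₁ : ℕ → ℕ
cantor₁ y = triangleRoot y ∸ cantor₂ y

cantor₂-cantor : ∀ s v → cantor₂ (cantor s v) ≡ v
cantor₂-cantor s v
  rewrite triangleRoot-correct v (s + v) (m≤n+m v s) = m+n∸n≡m v (triangle (s + v))

cantor₁-cantor : ∀ s v → cantor₁ (cantor s v) ≡ s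
cantor₁-cantor s v
  rewrite cantor₂-cantor s v | triangleRoot-correct v (s + v) (m≤n+m v s) = m+n∸n≡m s v

represented-triangle : Represented k (unary triangle)
represented-triangle = represented-rec represented-zero
  (represented-∘₂ represented-+
    (represented-∘₁ suc represented-suc (represented-lookup zero))
    (represented-lookup (suc zero)))
  (λ { [] → refl })
  (λ { m [] → refl })

represented-triangleRoot : Represented k (unary triangleRoot)
represented-triangleRoot = represented-rec represented-zero
  (represented-∘₂ represented-+ root
    (represented-∘₂ represented-∸ represented-one
      (represented-∘₂ represented-∸
        (represented-∘₁ triangle represented-triangle (represented-∘₁ suc represented-suc root))
        (represented-∘₁ suc represented-suc (represented-lookup zero)))))
  (λ { [] → refl })
  (λ { m [] → refl })
  where
  root : Represented k (λ xs → lookup {n = 2} xs (suc zero))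
  root = represented-lookup (suc zero)

represented-cantor₂ : Represented k (unary cantor₂)
represented-cantor₂ = represented-cong (λ { (_ ∷ []) → refl })
  (represented-∘₂ represented-∸ (represented-lookup zero)
    (represented-∘₁ triangle represented-triangle
      (represented-∘₁ triangleRoot represented-triangleRoot (represented-lookup zero))))

represented-cantor₁ : Represented k (unary cantor₁)
represented-cantor₁ =
  represented-∘₂ represented-∸ represented-triangleRoot represented-cantor₂

-- Tuple codes and the extended graph.

module _ (P : Pairing) where
  open Pairing P

  pair-injective : ∀ {w x y z} → pair w x ≡ pair y z → w ≡ y × x ≡ z
  pair-injective eq with refl ← proj₁ bijective eq = refl , refl

  tuple-injective : (xs ys : Vec ℕ (suc n)) → tuple xs ≡ tuple ys → xs ≡ ys
  tuple-injective (x ∷ []) (y ∷ []) eq = cong (_∷ []) eq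
  tuple-injective (x ∷ xs@(_ ∷ _)) (y ∷ ys@(_ ∷ _)) eq =
    let x≡y , eq′ = pair-injective eq in cong₂ _∷_ x≡y (tuple-injective xs ys eq′)

  tuple-computable : Computable (tuple {n})
  tuple-computable {0} =
    represented-cong (λ { (_ ∷ []) → refl }) (represented-lookup zero)
  tuple-computable {suc n} =
    represented-cong
      (λ { (x ∷ xs@(_ ∷ _)) → cong (pair x ∘ tuple) (tabulate∘lookup xs) })
      (represented-∘₂ computable (represented-lookup zero)
        (represented-reindex tuple-computable suc))

  -- The default elements have second component 0, so the successor excludes them; in the other case
  -- injectivity identifies both arguments and value.
  extendedGraph-suc : (f : PartialFun (suc n)) (xs : Vec ℕ (suc n)) (v : ℕ) →
    ExtendedGraph f (pair (tuple xs) (suc v)) → graph f xs v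
  extendedGraph-suc f xs v (inj₁ (_ , eq)) with () ← proj₂ (pair-injective eq)
  extendedGraph-suc f xs v (inj₂ (ys , _ , fys , eq))
    with xs≡ys , refl ← pair-injective eq
    with refl ← tuple-injective xs ys xs≡ys = fys

-- Strong induction on the witness: a bounded search either finds a smaller witness or shows that
-- this one is minimal.
least : {T : Pred ℕ 0ℓ} → Decidable T → ∀ y → T y →
  ∃[ z ] T z × (∀ w → w < z → ¬ T w)
least {T} T? = <-rec _ go
  where
  go : ∀ y → (∀ {z} → z < y → T z → ∃[ z ] T z × (∀ w → w < z → ¬ T w)) →
       T y → ∃[ z ] T z × (∀ w → w < z → ¬ T w)
  go y rec Ty with anyUpTo? T? y
  ... | yes (z , z<y , Tz) = rec z<y Tz
  ... | no  none           = y , Ty , λ w w<y Tw → none (w , w<y , Tw)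

theorem4p1 : (P : Pairing) (A : Pred ℕ 0ℓ) → Infinite A → CE A →
    (n : ℕ) → 1 ≤ n →
    (θ : ℕ → PartialFun n) → IsNumbering θ (𝓢 A n) → Pairing.QGN-I P θ →
    Σ (ℕ → ℕ) λ q → PrimitiveRecursive (unary q) ×
    (Σ (Pred (Vec ℕ (suc (suc n))) 0ℓ) λ T → ComputablePredicate T ×
    ((i : ℕ) (xs : Vec ℕ n) (v : ℕ) → graph (θ i) xs v ⇔ graph (q ∘ₚ μ T) (i ∷ xs) v))
theorem4p1 P A _ _ n _ θ _ (g , g-computable , graph⊆range , range⊆graph) =
  cantor₂ , represented-cantor₂ , T ,
  ≡-computablePredicate found-computable sought-computable ,
  λ i xs v → mk⇔ (to i xs v) (from i xs v)
  where
  open Pairing P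

  arguments : Vec ℕ (suc (suc n)) → Vec ℕ (suc n)
  arguments ys = tabulate (lookup ys ∘ inject₁)

  candidate : Vec ℕ (suc (suc n)) → ℕ
  candidate ys = lookup ys (fromℕ (suc n))

  found sought : Vec ℕ (suc (suc n)) → ℕ
  found  ys = g (cantor₁ (candidate ys))
  sought ys = pair (tuple (arguments ys)) (suc (cantor₂ (candidate ys)))

  T : Pred (Vec ℕ (suc (suc n))) 0ℓ
  T ys = found ys ≡ sought ys

  candidate-computable : Computable candidate
  candidate-computable = represented-lookup (fromℕ (suc n))

  found-computable : Computable found
  found-computable =
    represented-∘₁ g g-computable
      (represented-∘₁ cantor₁ represented-cantor₁ candidate-computable)

  sought-computable : Computable sought
  sought-computable = represented-∘₂ computable
    (represented-reindex (tuple-computable P) inject₁)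
    (represented-∘₁ suc represented-suc
      (represented-∘₁ cantor₂ represented-cantor₂ candidate-computable))

  -- `T` reads its parts off one vector by lookups, which suits composition of codes. On `xs ∷ʳ y`
  -- these lookups simplify only propositionally, so this form with separate arguments is reached by
  -- transport.
  Match : Vec ℕ (suc n) → ℕ → Set
  Match xs y = g (cantor₁ y) ≡ pair (tuple xs) (suc (cantor₂ y))

  T≡Match : ∀ xs y → T (xs ∷ʳ y) ≡ Match xs y
  T≡Match xs y = cong₂ Match (tabulate-inject₁-∷ʳ xs y) (lookup-fromℕ-∷ʳ xs y)

  -- Every match yields a correct value, whether or not it is the least one.
  match⇒graph : ∀ xs y → T (xs ∷ʳ y) → graph (joint θ) xs (cantor₂ y)
  match⇒graph xs y Ty = extendedGraph-suc P (joint θ) xs (cantor₂ y)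
    (range⊆graph (cantor₁ y , subst id (T≡Match xs y) Ty))

  graph⇒match : ∀ xs v → graph (joint θ) xs v → ∃[ y ] T (xs ∷ʳ y)
  -- The witness pairs a stage `s` at which `g` lists the graph point with the value `v` listed
  -- there.
  graph⇒match xs v fxs with s , gs≡ ← graph⊆range (inj₂ (xs , v , fxs , refl)) =
    cantor s v , subst id (sym (T≡Match xs (cantor s v)))
      (subst₂ (λ a b → g a ≡ pair (tuple xs) (suc b))
        (sym (cantor₁-cantor s v)) (sym (cantor₂-cantor s v)) gs≡)

  to : ∀ i xs v → graph (θ i) xs v → graph (cantor₂ ∘ₚ μ T) (i ∷ xs) v
  to i xs v θxs =
    let y₀ , Ty₀     = graph⇒match (i ∷ xs) v θxs
        y , Ty , y-min = least (λ y → found ((i ∷ xs) ∷ʳ y) ≟ sought ((i ∷ xs) ∷ʳ y)) y₀ Ty₀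
    -- The least match `y` may encode another stage than `y₀`, but single-valuedness of `θ i` forces
    -- its second component to be `v`.
    in  y , (Ty , y-min) , functional (θ i) θxs (match⇒graph (i ∷ xs) y Ty)

  from : ∀ i xs v → graph (cantor₂ ∘ₚ μ T) (i ∷ xs) v → graph (θ i) xs v
  from i xs _ (y , (Ty , _) , refl) = match⇒graph (i ∷ xs) y Ty
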